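{- $\mathrm{CTL}^*_f$ and $\mathrm{CTL}^*_\pm$ are expressively equivalent: every $\mathrm{CTL}^*_f$ state formula can be effectively translated into an initially equivalent $\mathrm{CTL}^*_\pm$ state formula, and vice versa.
   Context: Fix a finite set $AP$ and $\Sigma=2^{AP}$. A $\Sigma$-tree is an unranked (finitely many children per node), unordered, leafless (every node has a child) tree with labelling $t(v)\in\Sigma$. A path is a finite or infinite sequence of nodes, each (after the first) a child of the previous. $\mathrm{CTL}^*_f$: state formulae $\varphi ::= p\mid\neg\varphi\mid\varphi\lor\varphi\mid\mathsf{D}^n\varphi\mid\mathsf{E}^f\psi$, path formulae $\psi ::= \varphi\mid\neg\psi\mid\psi\lor\psi\mid\mathsf{X}\psi\mid\psi\,\mathsf{U}\,\psi\mid\psi\,\mathsf{R}\,\psi$. $(t,u)\models\mathsf{E}^f\psi$ iff there is a finite path $\pi$ from the root with $\pi(i)=u$ and $(t,\pi,i)\models\psi$, where path formulae are evaluated on finite paths: $\mathsf{X}\psi$ holds at $i$ iff $i$ is not the last position and $\psi$ holds at $i+1$; $\psi_1\mathsf{U}\psi_2$ iff some position $j\ge i$ satisfies $\psi_2$ and all $k\in[i,j)$ satisfy $\psi_1$; $\psi_1\mathsf{R}\psi_2$ iff all positions $j\ge i$ of $\pi$ satisfy $\psi_2$ or some $j\ge i$ satisfies $\psi_1\land\psi_2$ and all $k\in[i,j)$ satisfy $\psi_2$; a state formula holds at $i$ iff it holds at $(t,\pi(i))$. $\mathrm{CTL}^*_\pm$: state formulae $\varphi ::= p\mid\neg\varphi\mid\varphi\lor\varphi\mid\mathsf{D}^n\varphi\mid\mathsf{E}\psi$,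 path formulae $\psi ::= \varphi\mid\psi\land\psi\mid\psi\lor\psi\mid\mathsf{X}\psi\mid\psi\,\mathsf{U}\,\psi$ (no negation of path formulae, no $\mathsf{R}$). $(t,u)\models\mathsf{E}\psi$ iff there is an infinite path $\pi$ from the root with $\pi(i)=u$ and $(t,\pi,i)\models\psi$, with $\mathsf{X}$ and $\mathsf{U}$ interpreted as usual on infinite paths. In both logics: $p$ holds at $(t,u)$ iff $p\in t(u)$; Booleans as usual; $\mathsf{D}^n\varphi$ holds iff $u$ has at least $n$ distinct children satisfying $\varphi$. A tree is a model of a state formula if the formula holds at its root; initially equivalent formulae have the same models. -}

module Defs where

open import Data.Fin.Base as Fin using (Fin; toℕ; inject₁)
open import Data.Fin.Subset using (Subset) renaming (_∈_ to _∈ˢ_)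
open import Data.List.Base using (List)
open import Data.List.Membership.Propositional using (_∈_)
open import Data.Nat.Base using (ℕ; zero; suc; _≤_; _<_)
open import Data.Product.Base using (_×_; ∃-syntax; Σ-syntax)
open import Data.Sum.Base using (_⊎_)
open import Function.Bundles using (_⇔_)
open import Function.Definitions using (Injective)
open import Relation.Binary.Construct.Closure.ReflexiveTransitive using (Star)
open import Relation.Binary.PropositionalEquality using (_≡_)
open import Relation.Nullary.Negation using (¬_)

-- AP is Fin k throughout, so Σ = 2^AP is Subset k.

-- Child u v says that v is a child of u.  The list in finitelyBranching
-- only witnesses finiteness: no semantic clause refers to its order.
record Tree (k : ℕ) : Set₁ where
  field
    Node              : Set
    root              : Node
    Child             : Node → Node → Set
    label             : Node → Subset k
    root-orphan       : ∀ u → ¬ Child u root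
    parent-unique     : ∀ {u u′ v} → Child u v → Child u′ v → u ≡ u′
    reachable         : ∀ v → Star Child root v
    finitelyBranching : ∀ u → ∃[ vs ] (∀ v → Child u v ⇔ v ∈ vs)
    leafless          : ∀ u → ∃[ v ] Child u v

module _ {k : ℕ} (t : Tree k) where
  open Tree t

  -- A finite path has the positions 0, …, last, hence is nonempty.
  record FinitePath : Set where
    field
      last : ℕ
      at   : Fin (suc last) → Node
      step : ∀ (i : Fin last) → Child (at (inject₁ i)) (at (Fin.suc i))

  record InfinitePath : Set where
    field
      at   : ℕ → Node
      step : ∀ i → Child (at i) (at (suc i))

  AtLeastChildren : ℕ → Node → (Node → Set) → Set
  AtLeastChildren n u P =
    Σ[ c ∈ (Fin n → Node) ] Injective _≡_ _≡_ c × (∀ i → Child u (c i) × P (c i))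

module CTL*f where

  data StateFormula (k : ℕ) : Set
  data PathFormula  (k : ℕ) : Set

  data StateFormula k where
    atom : Fin k → StateFormula k
    neg  : StateFormula k → StateFormula k
    _∨_  : StateFormula k → StateFormula k → StateFormula k
    D    : ℕ → StateFormula k → StateFormula k
    Ef   : PathFormula k → StateFormula k

  data PathFormula k where
    state : StateFormula k → PathFormula k
    neg   : PathFormula k → PathFormula k
    _∨_   : PathFormula k → PathFormula k → PathFormula k
    X     : PathFormula k → PathFormula k
    _U_   : PathFormula k → PathFormula k → PathFormula k
    _R_   : PathFormula k → PathFormula k → PathFormula k

  module _ {k : ℕ} (t : Tree k) where
    open Tree t
    open FinitePath

    infix 4 _⊨_ _,_⊨ᵖ_

    _⊨_    : Node → StateFormula k → Set
    _,_⊨ᵖ_ : (π : FinitePath t) → Fin (suc (last π)) → PathFormula k → Set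

    u ⊨ atom p    = p ∈ˢ label u
    u ⊨ neg φ     = ¬ (u ⊨ φ)
    u ⊨ (φ₁ ∨ φ₂) = (u ⊨ φ₁) ⊎ (u ⊨ φ₂)
    u ⊨ D n φ     = AtLeastChildren t n u (λ v → v ⊨ φ)
    u ⊨ Ef ψ      = Σ[ π ∈ FinitePath t ] at π Fin.zero ≡ root ×
                      (∃[ i ] at π i ≡ u × (π , i ⊨ᵖ ψ))

    π , i ⊨ᵖ state φ   = at π i ⊨ φ
    π , i ⊨ᵖ neg ψ     = ¬ (π , i ⊨ᵖ ψ)
    π , i ⊨ᵖ (ψ₁ ∨ ψ₂) = (π , i ⊨ᵖ ψ₁) ⊎ (π , i ⊨ᵖ ψ₂)
    π , i ⊨ᵖ X ψ       = ∃[ j ] toℕ j ≡ suc (toℕ i) × (π , j ⊨ᵖ ψ)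
    π , i ⊨ᵖ (ψ₁ U ψ₂) =
      ∃[ j ] i Fin.≤ j × (π , j ⊨ᵖ ψ₂) ×
             (∀ m → i Fin.≤ m → m Fin.< j → π , m ⊨ᵖ ψ₁)
    π , i ⊨ᵖ (ψ₁ R ψ₂) =
      (∀ j → i Fin.≤ j → π , j ⊨ᵖ ψ₂)
      ⊎ (∃[ j ] i Fin.≤ j × ((π , j ⊨ᵖ ψ₁) × (π , j ⊨ᵖ ψ₂)) ×
                (∀ m → i Fin.≤ m → m Fin.< j → π , m ⊨ᵖ ψ₂))

  Models : {k : ℕ} → StateFormula k → Tree k → Set
  Models φ t = _⊨_ t (Tree.root t) φ

module CTL*± where

  data StateFormula (k : ℕ) : Set
  data PathFormula  (k : ℕ) : Set

  data StateFormula k where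
    atom : Fin k → StateFormula k
    neg  : StateFormula k → StateFormula k
    _∨_  : StateFormula k → StateFormula k → StateFormula k
    D    : ℕ → StateFormula k → StateFormula k
    E    : PathFormula k → StateFormula k

  data PathFormula k where
    state : StateFormula k → PathFormula k
    _∧_   : PathFormula k → PathFormula k → PathFormula k
    _∨_   : PathFormula k → PathFormula k → PathFormula k
    X     : PathFormula k → PathFormula k
    _U_   : PathFormula k → PathFormula k → PathFormula k

  module _ {k : ℕ} (t : Tree k) where
    open Tree t
    open InfinitePath

    infix 4 _⊨_ _,_⊨ᵖ_

    _⊨_    : Node → StateFormula k → Set
    _,_⊨ᵖ_ : InfinitePath t → ℕ → PathFormula k → Set

    u ⊨ atom p    = p ∈ˢ label u
    u ⊨ neg φ     = ¬ (u ⊨ φ)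
    u ⊨ (φ₁ ∨ φ₂) = (u ⊨ φ₁) ⊎ (u ⊨ φ₂)
    u ⊨ D n φ     = AtLeastChildren t n u (λ v → v ⊨ φ)
    u ⊨ E ψ       = Σ[ π ∈ InfinitePath t ] at π 0 ≡ root ×
                      (∃[ i ] at π i ≡ u × (π , i ⊨ᵖ ψ))

    π , i ⊨ᵖ state φ   = at π i ⊨ φ
    π , i ⊨ᵖ (ψ₁ ∧ ψ₂) = (π , i ⊨ᵖ ψ₁) × (π , i ⊨ᵖ ψ₂)
    π , i ⊨ᵖ (ψ₁ ∨ ψ₂) = (π , i ⊨ᵖ ψ₁) ⊎ (π , i ⊨ᵖ ψ₂)
    π , i ⊨ᵖ X ψ       = π , suc i ⊨ᵖ ψ
    π , i ⊨ᵖ (ψ₁ U ψ₂) =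
      ∃[ j ] i ≤ j × (π , j ⊨ᵖ ψ₂) × (∀ m → i ≤ m → m < j → π , m ⊨ᵖ ψ₁)

  Models : {k : ℕ} → StateFormula k → Tree k → Set
  Models φ t = _⊨_ t (Tree.root t) φ

-- The two formulae may come from different logics, so this compares their
-- classes of models.
InitiallyEquivalent : {k : ℕ} → (Tree k → Set) → (Tree k → Set) → Set₁
InitiallyEquivalent {k} M N = (t : Tree k) → M t ⇔ N t

{-# OPTIONS --safe #-}
module Submission where

-- A positive path formula holds on an infinite path iff it holds on some finite
-- prefix, and since trees are leafless every finite path extends to an infinite
-- one; so CTL*± embeds into CTL*f connective by connective.
--
-- Conversely, an LTL formula Φ over finite words must be turned into a positive
-- formula that holds in a word iff some prefix satisfies Φ.  Read from its right
-- end, a word determines the value of each `next` and `until` by a flip-flop,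
-- i.e. a bit that every letter sets, resets or keeps.  A flip-flop occurring in a
-- future formula can be eliminated without introducing negations of temporal
-- operators: along an `until`, the state is fixed between two switching letters,
-- so it suffices to demand at each switching letter that the left argument,
-- specialised to the new state, lasts up to the next switch.  Eliminating
-- flip-flops once, on the reversed word, gives the reversal of Φ; eliminating
-- those of the reversal from "eventually, the past satisfies the reversal of Φ"
-- gives the positive formula.

open import Defs
open import Axiom.ExcludedMiddle using (ExcludedMiddle)
open import Data.Bool.Base using (Bool; true; false; not; _∧_; _∨_; if_then_else_)
open import Data.Bool.Properties using (∨-identityʳ; ∨-zeroʳ; ∨-inverseʳ; not-involutive)
open import Data.Fin.Base as Fin using (Fin; toℕ; fromℕ<)
open import Data.Fin.Properties using (toℕ-injective; toℕ-fromℕ<; toℕ-inject₁; toℕ<n; toℕ≤pred[n])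
open import Data.List.Base using (List; []; _∷_; _ʳ++_; reverse; length; take)
open import Data.List.Properties using (reverse-involutive)
open import Data.List.Relation.Binary.Pointwise.Base using (Pointwise; []; _∷_)
open import Data.Maybe.Base using (Maybe; just; nothing; maybe′)
open import Data.Nat.Base using (ℕ; zero; suc; _+_; _∸_; _≤_; _<_; s≤s; z≤n; _⊔_)
open import Data.Nat.Properties
  using (≤-refl; ≤-trans; ≤-reflexive; <-irrefl; <⇒≤; n≤1+n; m≤m+n; m≤m⊔n; m≤n⊔m; +-suc;
         +-identityʳ; +-comm; m+[n∸m]≡n; m≤n⇒m<n∨m≡n; <-cmp; ≤-<-trans; <-≤-trans)
open import Data.Product.Base as Product using (_×_; _,_; proj₁; proj₂; Σ-syntax; ∃-syntax)
open import Data.Sum.Base as Sum using (_⊎_; inj₁; inj₂)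
open import Data.Sum.Function.Propositional using (_⊎-⇔_)
open import Function.Base using (_∘_; id)
open import Function.Bundles using (_⇔_; mk⇔; Equivalence)
open import Function.Construct.Composition using (_⇔-∘_)
open import Function.Construct.Symmetry using (⇔-sym)
open import Level using (0ℓ)
open import Relation.Binary.Definitions using (tri<; tri≈; tri>)
open import Relation.Binary.PropositionalEquality
open import Relation.Nullary.Decidable using (Dec; yes; no; does; dec-true; dec-false; decidable-stable)
open import Relation.Nullary.Negation using (¬_; contradiction)

-- Boolean expressions and linear temporal logic over finite words

private variable
  A B : Set

infixr 5 _or_
infixr 6 _and_

data BoolExpr (A : Set) : Set where
  const : Bool → BoolExpr A
  var   : A → BoolExpr A
  neg   : BoolExpr A → BoolExpr A
  _or_  : BoolExpr A → BoolExpr A → BoolExpr A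
  _and_ : BoolExpr A → BoolExpr A → BoolExpr A

eval : BoolExpr A → (A → Bool) → Bool
eval (const b) x = b
eval (var a)   x = x a
eval (neg α)   x = not (eval α x)
eval (α or β)  x = eval α x ∨ eval β x
eval (α and β) x = eval α x ∧ eval β x

bind : (A → BoolExpr B) → BoolExpr A → BoolExpr B
bind σ (const b) = const b
bind σ (var a)   = σ a
bind σ (neg α)   = neg (bind σ α)
bind σ (α or β)  = bind σ α or bind σ β
bind σ (α and β) = bind σ α and bind σ β

eval-bind : (σ : A → BoolExpr B) {x : B → Bool} {y : A → Bool} →
            (∀ a → eval (σ a) x ≡ y a) → ∀ α → eval (bind σ α) x ≡ eval α y
eval-bind σ p (const b) = refl
eval-bind σ p (var a)   = p a
eval-bind σ p (neg α)   = cong not (eval-bind σ p α)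
eval-bind σ p (α or β)  = cong₂ _∨_ (eval-bind σ p α) (eval-bind σ p β)
eval-bind σ p (α and β) = cong₂ _∧_ (eval-bind σ p α) (eval-bind σ p β)

-- Negation of temporal formulae exists at `full` only, so a construction polymorphic in the kind
-- sends positive formulae to positive ones. Boolean expressions inside `lit` may be negated at
-- either kind.
data Kind : Set where
  positive full : Kind

private variable
  κ κ′ : Kind

data LTL (A : Set) : Kind → Set where
  lit     : BoolExpr A → LTL A κ
  neg     : LTL A full → LTL A full
  _or_    : LTL A κ → LTL A κ → LTL A κ
  _and_   : LTL A κ → LTL A κ → LTL A κ
  next    : LTL A κ → LTL A κ
  _until_ : LTL A κ → LTL A κ → LTL A κ

Word : Set → Set
Word A = List (A → Bool)

-- No formula, not even a negated one, holds in the empty word; this makes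
-- `next` strong.
sat : LTL A κ → Word A → Bool
sat Φ           []       = false
sat (lit α)     (x ∷ xs) = eval α x
sat (neg Φ)     (x ∷ xs) = not (sat Φ (x ∷ xs))
sat (Φ or Ψ)    (x ∷ xs) = sat Φ (x ∷ xs) ∨ sat Ψ (x ∷ xs)
sat (Φ and Ψ)   (x ∷ xs) = sat Φ (x ∷ xs) ∧ sat Ψ (x ∷ xs)
sat (next Φ)    (x ∷ xs) = sat Φ xs
sat (Φ until Ψ) (x ∷ xs) = sat Ψ (x ∷ xs) ∨ (sat Φ (x ∷ xs) ∧ sat (Φ until Ψ) xs)

subst-LTL : (A → BoolExpr B) → LTL A κ → LTL B κ
subst-LTL σ (lit α)     = lit (bind σ α)
subst-LTL σ (neg Φ)     = neg (subst-LTL σ Φ)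
subst-LTL σ (Φ or Ψ)    = subst-LTL σ Φ or subst-LTL σ Ψ
subst-LTL σ (Φ and Ψ)   = subst-LTL σ Φ and subst-LTL σ Ψ
subst-LTL σ (next Φ)    = next (subst-LTL σ Φ)
subst-LTL σ (Φ until Ψ) = subst-LTL σ Φ until subst-LTL σ Ψ

Realises : (A → BoolExpr B) → (B → Bool) → (A → Bool) → Set
Realises σ x y = ∀ a → eval (σ a) x ≡ y a

sat-subst : (σ : A → BoolExpr B) (Φ : LTL A κ) {xs : Word B} {ys : Word A} →
            Pointwise (Realises σ) xs ys → sat (subst-LTL σ Φ) xs ≡ sat Φ ys
sat-subst σ Φ           []         = refl
sat-subst σ (lit α)     (p ∷ _)    = eval-bind σ p α
sat-subst σ (neg Φ)     ps@(_ ∷ _) = cong not (sat-subst σ Φ ps)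
sat-subst σ (Φ or Ψ)    ps@(_ ∷ _) = cong₂ _∨_ (sat-subst σ Φ ps) (sat-subst σ Ψ ps)
sat-subst σ (Φ and Ψ)   ps@(_ ∷ _) = cong₂ _∧_ (sat-subst σ Φ ps) (sat-subst σ Ψ ps)
sat-subst σ (next Φ)    (_ ∷ ps)   = sat-subst σ Φ ps
sat-subst σ (Φ until Ψ) qs@(_ ∷ ps) =
  cong₂ _∨_ (sat-subst σ Ψ qs) (cong₂ _∧_ (sat-subst σ Φ qs) (sat-subst σ (Φ until Ψ) ps))

-- `nothing` is a fresh proposition with value `v`; the old ones move under `just`.
_▸_ : (A → Bool) → Bool → Maybe A → Bool
x ▸ v = maybe′ x v

sat-or : (Φ Ψ : LTL A κ) → ∀ xs → sat (Φ or Ψ) xs ≡ sat Φ xs ∨ sat Ψ xs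
sat-or Φ Ψ []      = refl
sat-or Φ Ψ (_ ∷ _) = refl

sat-and : (Φ Ψ : LTL A κ) → ∀ xs → sat (Φ and Ψ) xs ≡ sat Φ xs ∧ sat Ψ xs
sat-and Φ Ψ []      = refl
sat-and Φ Ψ (_ ∷ _) = refl

-- Eliminating a flip-flop

select : ∀ b (g : Bool → Bool) → (b ∧ g true) ∨ (not b ∧ g false) ≡ g b
select true  g = ∨-identityʳ (g true)
select false g = refl

-- The expansion laws behind `Until.result` below, at one letter: φ and ψ are
-- the values of the arguments of `until` there, and e, p, m those of `final`,
-- `phase` and `phases` at the next letter.
private
  unfold-true : ∀ s k φ ψ e₁ e₀ p₁ p₀ m →
    (ψ ∨ ((φ ∧ not (not (s ∨ k))) ∧ e₁)) ∨
    (((φ ∧ not (s ∨ k)) ∨ (φ ∧ p₁)) ∧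
     (((s ∧ e₁) ∨ (not (s ∨ k) ∧ e₀)) ∨
      (((not s ∨ p₁) ∧ (not (not (s ∨ k)) ∨ p₀)) ∧ m)))
    ≡
    ψ ∨ (φ ∧ ((if s ∨ (k ∧ true) then e₁ else e₀) ∨ ((if s ∨ (k ∧ true) then p₁ else p₀) ∧ m)))
  unfold-true s k φ true e₁ e₀ p₁ p₀ m = refl
  unfold-true s k false false e₁ e₀ p₁ p₀ m = refl
  unfold-true true k true false true e₀ p₁ p₀ m = refl
  unfold-true true k true false false e₀ false p₀ m = refl
  unfold-true true k true false false e₀ true p₀ m = refl
  unfold-true false true true false true e₀ p₁ p₀ m = refl
  unfold-true false true true false false e₀ false p₀ m = refl
  unfold-true false true true false false e₀ true p₀ m = refl
  unfold-true false false true false e₁ e₀ p₁ p₀ m = refl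

  unfold-false : ∀ s k φ ψ e₁ e₀ p₁ p₀ m →
    (ψ ∨ ((φ ∧ not s) ∧ e₀)) ∨
    (((φ ∧ s) ∨ (φ ∧ p₀)) ∧
     (((s ∧ e₁) ∨ (not (s ∨ k) ∧ e₀)) ∨
      (((not s ∨ p₁) ∧ (not (not (s ∨ k)) ∨ p₀)) ∧ m)))
    ≡
    ψ ∨ (φ ∧ ((if s ∨ (k ∧ false) then e₁ else e₀) ∨ ((if s ∨ (k ∧ false) then p₁ else p₀) ∧ m)))
  unfold-false s k φ true e₁ e₀ p₁ p₀ m = refl
  unfold-false s k false false e₁ e₀ p₁ p₀ m = refl
  unfold-false true k true false true e₀ p₁ p₀ m = refl
  unfold-false true k true false false e₀ false p₀ m = refl
  unfold-false true k true false false e₀ true p₀ m = refl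
  unfold-false false true true false e₁ true p₁ p₀ m = refl
  unfold-false false true true false e₁ false p₁ false m = refl
  unfold-false false true true false e₁ false p₁ true m = refl
  unfold-false false false true false e₁ true p₁ p₀ m = refl
  unfold-false false false true false e₁ false p₁ false m = refl
  unfold-false false false true false e₁ false p₁ true m = refl

-- A flip-flop is a bit v that each letter updates to s ∨ (k ∧ v).
module FlipFlop {A : Set} (s k : BoolExpr A) where

  update : Bool → (A → Bool) → Bool
  update v x = eval s x ∨ (eval k x ∧ v)

  -- A letter carries the state in which it is read, before its own update.
  track : Bool → Word A → Word (Maybe A)
  track v []       = []
  track v (x ∷ xs) = (x ▸ v) ∷ track (update v x) xs

  fixBit : Bool → Maybe A → BoolExpr A
  fixBit v nothing  = const v
  fixBit v (just a) = var a

  updated : Bool → BoolExpr A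
  updated v = s or k and const v

  -- The letters that move both states to the given one; every other letter
  -- keeps the state.
  switch : Bool → BoolExpr A
  switch true  = s
  switch false = neg (s or k)

  module Until (Φ Ψ : Bool → LTL A κ) where

    -- A maximal stretch in state b, including the letter that leaves it.
    phase : Bool → LTL A κ
    phase b = Φ b until (Φ b and lit (switch (not b)))

    -- The last stretch, in which Ψ is reached before the state changes.
    final : Bool → LTL A κ
    final b = (Φ b and lit (neg (switch (not b)))) until Ψ b

    -- A switching letter fixes the next state whatever the current one, so no state index is
    -- needed. A switching letter that happens to keep the state repeats a demand that the
    -- surrounding stretch already meets.
    phases : LTL A κ
    phases =
      ((lit (neg (switch true)) or next (phase true)) and
       (lit (neg (switch false)) or next (phase false)))
      until
      ((lit (switch true) and next (final true)) or
       (lit (switch false) and next (final false)))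

    result : Bool → LTL A κ
    result v = final v or (phase v and phases)

  -- The next state is a condition on the current letter and state, so branching on it negates only
  -- Boolean expressions and the kind is kept.
  absorb : Bool → LTL (Maybe A) κ → LTL A κ
  absorb v (lit α)     = lit (bind (fixBit v) α)
  absorb v (neg Φ)     = neg (absorb v Φ)
  absorb v (Φ or Ψ)    = absorb v Φ or absorb v Ψ
  absorb v (Φ and Ψ)   = absorb v Φ and absorb v Ψ
  absorb v (next Φ)    =
    (lit (updated v) and next (absorb true Φ)) or
    (lit (neg (updated v)) and next (absorb false Φ))
  absorb v (Φ until Ψ) =
    Until.result (λ b → absorb b Φ) (λ b → absorb b Ψ) v

  fixBit-realises : ∀ v x → Realises (fixBit v) x (x ▸ v)
  fixBit-realises v x nothing  = refl
  fixBit-realises v x (just a) = refl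

  -- Induction on the word: `result` obeys the one-letter expansion law of `until`, with the state
  -- updated in passing. Correctness for the two arguments is a hypothesis, which leaves the
  -- recursion to the word alone.
  sat-absorb-until : (Φ Ψ : LTL (Maybe A) κ) →
    (∀ v xs → sat (absorb v Φ) xs ≡ sat Φ (track v xs)) →
    (∀ v xs → sat (absorb v Ψ) xs ≡ sat Ψ (track v xs)) →
    ∀ v xs → sat (absorb v (Φ until Ψ)) xs ≡ sat (Φ until Ψ) (track v xs)
  sat-absorb-until Φ Ψ p q v []       = refl
  sat-absorb-until Φ Ψ p q v (x ∷ xs) = begin
    sat (result v) (x ∷ xs)
      ≡⟨ unfold v ⟩
    sat (absorb v Ψ) (x ∷ xs) ∨ (sat (absorb v Φ) (x ∷ xs) ∧ tailResult (update v x))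
      ≡⟨ cong (λ b → sat (absorb v Ψ) (x ∷ xs) ∨ (sat (absorb v Φ) (x ∷ xs) ∧ b))
              (trans (tailResult≡ (update v x)) (sat-absorb-until Φ Ψ p q (update v x) xs)) ⟩
    sat (absorb v Ψ) (x ∷ xs) ∨
      (sat (absorb v Φ) (x ∷ xs) ∧ sat (Φ until Ψ) (track (update v x) xs))
      ≡⟨ cong₂ (λ b c → b ∨ (c ∧ sat (Φ until Ψ) (track (update v x) xs)))
               (q v (x ∷ xs)) (p v (x ∷ xs)) ⟩
    sat (Φ until Ψ) (track v (x ∷ xs)) ∎
    where
    open ≡-Reasoning
    open Until (λ b → absorb b Φ) (λ b → absorb b Ψ)

    -- `sat (result b) xs` is stuck on the variable `xs`; its expansion is spelled out so that
    -- `unfold` becomes a purely Boolean identity.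
    tailResult : Bool → Bool
    tailResult b = (if b then (sat (final true) xs) else (sat (final false)) xs) ∨
                   ((if b then (sat (phase true) xs) else (sat (phase false)) xs) ∧ sat phases xs)

    tailResult≡ : ∀ b → tailResult b ≡ sat (result b) xs
    tailResult≡ true  = sym (trans (sat-or (final true) _ xs)
                          (cong (sat (final true) xs ∨_) (sat-and (phase true) phases xs)))
    tailResult≡ false = sym (trans (sat-or (final false) _ xs)
                          (cong (sat (final false) xs ∨_) (sat-and (phase false) phases xs)))

    unfold : ∀ v → sat (result v) (x ∷ xs) ≡
             sat (absorb v Ψ) (x ∷ xs) ∨ (sat (absorb v Φ) (x ∷ xs) ∧ tailResult (update v x))
    unfold true  = unfold-true (eval s x) (eval k x)
      (sat (absorb true Φ) (x ∷ xs)) (sat (absorb true Ψ) (x ∷ xs))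
      (sat (final true) xs) (sat (final false) xs)
      (sat (phase true) xs) (sat (phase false) xs) (sat phases xs)
    unfold false = unfold-false (eval s x) (eval k x)
      (sat (absorb false Φ) (x ∷ xs)) (sat (absorb false Ψ) (x ∷ xs))
      (sat (final true) xs) (sat (final false) xs)
      (sat (phase true) xs) (sat (phase false) xs) (sat phases xs)

  sat-absorb : (Φ : LTL (Maybe A) κ) → ∀ v xs → sat (absorb v Φ) xs ≡ sat Φ (track v xs)
  sat-absorb Φ           v []          = refl
  sat-absorb (lit α)     v (x ∷ xs)    = eval-bind (fixBit v) (fixBit-realises v x) α
  sat-absorb (neg Φ)     v xs@(_ ∷ _)  = cong not (sat-absorb Φ v xs)
  sat-absorb (Φ or Ψ)    v xs@(_ ∷ _)  = cong₂ _∨_ (sat-absorb Φ v xs) (sat-absorb Ψ v xs)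
  sat-absorb (Φ and Ψ)   v xs@(_ ∷ _)  = cong₂ _∧_ (sat-absorb Φ v xs) (sat-absorb Ψ v xs)
  sat-absorb (next Φ)    v (x ∷ xs)    =
    trans (select (update v x) (λ b → sat (absorb b Φ) xs)) (sat-absorb Φ (update v x) xs)
  sat-absorb (Φ until Ψ) v xs@(_ ∷ _)  =
    sat-absorb-until Φ Ψ (sat-absorb Φ) (sat-absorb Ψ) v xs

-- Eliminating a past formula

-- Annotates every letter of a word with the value of Φ on the word read
-- backwards from that letter: a formula over the annotated word refers to the
-- past through Φ.  The list h holds the letters read so far, latest first.
annotate : LTL B κ → (B → A) → Word B → Word A → Word (Maybe A)
annotate Φ f h []       = []
annotate Φ f h (x ∷ xs) = (x ▸ sat Φ (x ∘ f ∷ h)) ∷ annotate Φ f (x ∘ f ∷ h) xs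

litSubst : (B → A) → BoolExpr B → Maybe A → BoolExpr A
litSubst f α nothing  = bind (var ∘ f) α
litSubst f α (just a) = var a

negSubst : Maybe A → BoolExpr (Maybe A)
negSubst nothing  = neg (var nothing)
negSubst (just a) = var (just a)

-- Annotations nest: the latest is `nothing`, the one before it `just nothing`, and the original
-- letter lies deepest. Here they are the values of the right and of the left argument.
pairSubst : (∀ {C} → BoolExpr C → BoolExpr C → BoolExpr C) → Maybe A → BoolExpr (Maybe (Maybe A))
pairSubst _⊕_ nothing  = var (just nothing) ⊕ var nothing
pairSubst _⊕_ (just a) = var (just (just a))

-- The outermost proposition is the flip-flop state, here the value of the argument one letter
-- earlier.
nextSubst : Maybe A → BoolExpr (Maybe (Maybe A))
nextSubst nothing  = var nothing
nextSubst (just a) = var (just (just a))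

-- From the outside in: the state, which is the value of the `until` one letter earlier, then the
-- right argument, then the left one.
untilSubst : Maybe A → BoolExpr (Maybe (Maybe (Maybe A)))
untilSubst nothing  = var (just nothing) or var (just (just nothing)) and var nothing
untilSubst (just a) = var (just (just (just a)))

-- Read backwards, `next` and `until` are flip-flops driven by their arguments.
separate : LTL B κ → (B → A) → LTL (Maybe A) κ′ → LTL A κ′
separate (lit α)     f Θ = subst-LTL (litSubst f α) Θ
separate (neg Φ)     f Θ = separate Φ f (subst-LTL negSubst Θ)
separate (Φ or Ψ)    f Θ = separate Φ f (separate Ψ (just ∘ f) (subst-LTL (pairSubst _or_) Θ))
separate (Φ and Ψ)   f Θ = separate Φ f (separate Ψ (just ∘ f) (subst-LTL (pairSubst _and_) Θ))
separate (next Φ)    f Θ =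
  separate Φ f (FlipFlop.absorb (var nothing) (const false) false (subst-LTL nextSubst Θ))
separate (Φ until Ψ) f Θ =
  separate Φ f (separate Ψ (just ∘ f)
    (FlipFlop.absorb (var nothing) (var (just nothing)) false (subst-LTL untilSubst Θ)))

private
  litSubst-realises : (f : B → A) (α : BoolExpr B) → ∀ h xs →
    Pointwise (Realises (litSubst f α)) xs (annotate {κ = κ} (lit α) f h xs)
  litSubst-realises f α h []       = []
  litSubst-realises f α h (x ∷ xs) = (λ where
    nothing  → eval-bind (var ∘ f) (λ _ → refl) α
    (just _) → refl) ∷ litSubst-realises f α _ xs

  negSubst-realises : (Φ : LTL B full) (f : B → A) → ∀ h xs →
    Pointwise (Realises negSubst) (annotate Φ f h xs) (annotate (neg Φ) f h xs)
  negSubst-realises Φ f h []       = []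
  negSubst-realises Φ f h (x ∷ xs) =
    (λ where nothing → refl ; (just _) → refl) ∷ negSubst-realises Φ f _ xs

  orSubst-realises : (Φ Ψ : LTL B κ) (f : B → A) → ∀ h xs →
    Pointwise (Realises (pairSubst _or_))
      (annotate Ψ (just ∘ f) h (annotate Φ f h xs)) (annotate (Φ or Ψ) f h xs)
  orSubst-realises Φ Ψ f h []       = []
  orSubst-realises Φ Ψ f h (x ∷ xs) =
    (λ where nothing → refl ; (just _) → refl) ∷ orSubst-realises Φ Ψ f _ xs

  andSubst-realises : (Φ Ψ : LTL B κ) (f : B → A) → ∀ h xs →
    Pointwise (Realises (pairSubst _and_))
      (annotate Ψ (just ∘ f) h (annotate Φ f h xs)) (annotate (Φ and Ψ) f h xs)
  andSubst-realises Φ Ψ f h []       = []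
  andSubst-realises Φ Ψ f h (x ∷ xs) =
    (λ where nothing → refl ; (just _) → refl) ∷ andSubst-realises Φ Ψ f _ xs

  -- Invariant: the state is the value of `Φ` on the letters already read. It starts as `false`
  -- since no formula holds in the empty word.
  nextSubst-realises : (Φ : LTL B κ) (f : B → A) → ∀ h v xs → v ≡ sat Φ h →
    Pointwise (Realises nextSubst)
      (FlipFlop.track (var nothing) (const false) v (annotate Φ f h xs)) (annotate (next Φ) f h xs)
  nextSubst-realises Φ f h v []       p = []
  nextSubst-realises Φ f h v (x ∷ xs) p =
    (λ where nothing → p ; (just _) → refl) ∷ nextSubst-realises Φ f _ _ xs (∨-identityʳ _)

  -- The update of this flip-flop is by definition the clause of `sat` for `until`, so `refl`
  -- preserves the invariant.
  untilSubst-realises : (Φ Ψ : LTL B κ) (f : B → A) → ∀ h v xs → v ≡ sat (Φ until Ψ) h →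
    Pointwise (Realises untilSubst)
      (FlipFlop.track (var nothing) (var (just nothing)) v (annotate Ψ (just ∘ f) h (annotate Φ f h xs)))
      (annotate (Φ until Ψ) f h xs)
  untilSubst-realises Φ Ψ f h v []       p = []
  untilSubst-realises Φ Ψ f h v (x ∷ xs) refl =
    (λ where nothing → refl ; (just _) → refl) ∷ untilSubst-realises Φ Ψ f _ _ xs refl

sat-separate : (Φ : LTL B κ) (f : B → A) (Θ : LTL (Maybe A) κ′) → ∀ xs →
               sat (separate Φ f Θ) xs ≡ sat Θ (annotate Φ f [] xs)
sat-separate {κ = κ} (lit α) f Θ xs =
  sat-subst _ Θ (litSubst-realises {κ = κ} f α [] xs)
sat-separate (neg Φ) f Θ xs =
  trans (sat-separate Φ f _ xs) (sat-subst _ Θ (negSubst-realises Φ f [] xs))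
sat-separate (Φ or Ψ) f Θ xs =
  trans (sat-separate Φ f _ xs)
    (trans (sat-separate Ψ (just ∘ f) (subst-LTL (pairSubst _or_) Θ) (annotate Φ f [] xs))
      (sat-subst _ Θ (orSubst-realises Φ Ψ f [] xs)))
sat-separate (Φ and Ψ) f Θ xs =
  trans (sat-separate Φ f _ xs)
    (trans (sat-separate Ψ (just ∘ f) (subst-LTL (pairSubst _and_) Θ) (annotate Φ f [] xs))
      (sat-subst _ Θ (andSubst-realises Φ Ψ f [] xs)))
sat-separate (next Φ) f Θ xs =
  trans (sat-separate Φ f _ xs)
    (trans (FlipFlop.sat-absorb _ _ (subst-LTL nextSubst Θ) false (annotate Φ f [] xs))
      (sat-subst nextSubst Θ (nextSubst-realises Φ f [] false xs refl)))
sat-separate (Φ until Ψ) f Θ xs =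
  trans (sat-separate Φ f _ xs)
    (trans (sat-separate Ψ (just ∘ f) (absorb false (subst-LTL untilSubst Θ)) (annotate Φ f [] xs))
      (trans (sat-absorb (subst-LTL untilSubst Θ) false (annotate Ψ (just ∘ f) [] (annotate Φ f [] xs)))
        (sat-subst untilSubst Θ (untilSubst-realises Φ Ψ f [] false xs refl))))
  where open FlipFlop (var nothing) (var (just nothing))

-- Reversal and prefixes

eventually : LTL A κ → LTL A κ
eventually Φ = lit (const true) until Φ

isLast : LTL A full
isLast = neg (next (lit (const true)))

-- At the last letter, the past read backwards is the reversal of the whole word; `Φ` is evaluated
-- there. `isLast` contains a negation, so the result is only `full`.
rev : LTL A full → LTL A full
rev Φ = separate Φ id (eventually (isLast and lit (var nothing)))

sat-rev : (Φ : LTL A full) → ∀ xs → sat (rev Φ) (reverse xs) ≡ sat Φ xs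
sat-rev Φ xs = trans (sat-separate Φ id _ (reverse xs))
  (trans (atEnd (reverse xs)) (cong (sat Φ) (reverse-involutive xs)))
  where
  atLast : ∀ h y ys → sat (eventually (isLast and lit (var nothing))) (annotate Φ id h (y ∷ ys)) ≡
                      sat Φ (ys ʳ++ (y ∷ h))
  atLast h y []       = ∨-identityʳ _
  atLast h y (z ∷ zs) = atLast (y ∷ h) z zs

  atEnd : ∀ ys → sat (eventually (isLast and lit (var nothing))) (annotate Φ id [] ys) ≡
                 sat Φ (reverse ys)
  atEnd []       = refl
  atEnd (y ∷ ys) = atLast [] y ys

-- The past of a letter, read backwards, is a reversed prefix, on which `rev Φ` has the value of `Φ`
-- on that prefix. Any letter will do, so `isLast` is dropped and the result is positive although
-- `rev Φ` is not.
somePrefix : LTL A full → LTL A positive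
somePrefix Φ = separate (rev Φ) id (eventually (lit (var nothing)))

sat-somePrefix⁺ : (Φ : LTL A full) → ∀ xs → sat Φ xs ≡ true → sat (somePrefix Φ) xs ≡ true
sat-somePrefix⁺ Φ xs p = trans (sat-separate (rev Φ) id _ xs)
  -- The prefix is the whole word, nonempty because no formula holds in `[]`.
  (whole [] xs (λ where refl → contradiction p λ ()) (trans (sat-rev Φ xs) p))
  where
  whole : ∀ h ys → ys ≢ [] → sat (rev Φ) (ys ʳ++ h) ≡ true →
          sat (eventually {κ = positive} (lit (var nothing))) (annotate (rev Φ) id h ys) ≡ true
  whole h []           q r = contradiction refl q
  whole h (y ∷ [])     q r = cong (_∨ false) r
  whole h (y ∷ z ∷ zs) q r =
    trans (cong (sat (rev Φ) (y ∷ h) ∨_) (whole (y ∷ h) (z ∷ zs) (λ ()) r)) (∨-zeroʳ _)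

sat-somePrefix⁻ : (Φ : LTL A full) → ∀ xs → sat (somePrefix Φ) xs ≡ true →
                  ∃[ n ] n ≤ length xs × sat Φ (take n xs) ≡ true
sat-somePrefix⁻ Φ xs p with search [] xs (trans (sym (sat-separate (rev Φ) id _ xs)) p)
  where
  search : ∀ h ys → sat (eventually {κ = positive} (lit (var nothing))) (annotate (rev Φ) id h ys) ≡ true →
           ∃[ n ] n ≤ length ys × sat (rev Φ) (take n ys ʳ++ h) ≡ true
  search h (y ∷ ys) q with sat (rev Φ) (y ∷ h) in eq
  ... | true  = 1 , s≤s z≤n , eq
  ... | false with n , n≤ , r ← search (y ∷ h) ys q = suc n , s≤s n≤ , r
... | n , n≤ , q = n , n≤ , trans (sym (sat-rev Φ (take n xs))) q

-- Segments of infinite words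

segment : (ℕ → A) → ℕ → ℕ → List A
segment g i zero    = []
segment g i (suc n) = g i ∷ segment g (suc i) n

length-segment : (g : ℕ → A) → ∀ i n → length (segment g i n) ≡ n
length-segment g i zero    = refl
length-segment g i (suc n) = cong suc (length-segment g (suc i) n)

take-segment : (g : ℕ → A) → ∀ i {m n} → m ≤ n → take m (segment g i n) ≡ segment g i m
take-segment g i z≤n       = refl
take-segment g i (s≤s m≤n) = cong (g i ∷_) (take-segment g (suc i) m≤n)

∨-true⁻ : ∀ a {b} → a ∨ b ≡ true → a ≡ true ⊎ b ≡ true
∨-true⁻ true  p = inj₁ refl
∨-true⁻ false p = inj₂ p

∨-true⁺ : ∀ a {b} → a ≡ true ⊎ b ≡ true → a ∨ b ≡ true
∨-true⁺ a (inj₁ refl) = refl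
∨-true⁺ a (inj₂ refl) = ∨-zeroʳ a

∧-true⁻ : ∀ a {b} → a ∧ b ≡ true → a ≡ true × b ≡ true
∧-true⁻ true p = refl , p

∧-true⁺ : ∀ a {b} → a ≡ true × b ≡ true → a ∧ b ≡ true
∧-true⁺ a (refl , q) = q

de-morgan : ∀ a b → not (not a ∨ not b) ≡ a ∧ b
de-morgan true  b = not-involutive b
de-morgan false b = refl

not-true⁺ : ∀ b → ¬ b ≡ true → not b ≡ true
not-true⁺ true  p = contradiction refl p
not-true⁺ false p = refl

not-true⁻ : ∀ b → not b ≡ true → ¬ b ≡ true
not-true⁻ false p ()

-- With strong `next` and no temporal negation, a true formula has its witnesses inside the shorter
-- segment, with which the longer one begins.
sat-mono : (Φ : LTL A positive) (x : ℕ → A → Bool) → ∀ i {m n} → m ≤ n →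
           sat Φ (segment x i m) ≡ true → sat Φ (segment x i n) ≡ true
sat-mono (lit α)     x i (s≤s m≤n)     p = p
sat-mono (Φ or Ψ)    x i m≤n@(s≤s _) p =
  ∨-true⁺ _ (Sum.map (sat-mono Φ x i m≤n) (sat-mono Ψ x i m≤n) (∨-true⁻ _ p))
sat-mono (Φ and Ψ)   x i m≤n@(s≤s _) p =
  ∧-true⁺ _ (Product.map (sat-mono Φ x i m≤n) (sat-mono Ψ x i m≤n) (∧-true⁻ _ p))
sat-mono (next Φ)    x i (s≤s m≤n)   p = sat-mono Φ x (suc i) m≤n p
sat-mono (Φ until Ψ) x i m≤n@(s≤s l) p =
  ∨-true⁺ _ (Sum.map (sat-mono Ψ x i m≤n)
    (∧-true⁺ _ ∘ Product.map (sat-mono Φ x i m≤n) (sat-mono (Φ until Ψ) x (suc i) l) ∘ ∧-true⁻ _)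
    (∨-true⁻ _ p))

-- Positions of finite words

module Positions (N : ℕ) where

  Until Release : (P Q : Fin N → Set) → Fin N → Set
  Until P Q i = ∃[ j ] i Fin.≤ j × Q j × (∀ l → i Fin.≤ l → l Fin.< j → P l)
  Release P Q i =
    (∀ j → i Fin.≤ j → Q j)
    ⊎ (∃[ j ] i Fin.≤ j × (P j × Q j) × (∀ l → i Fin.≤ l → l Fin.< j → Q l))

  Next : (Fin N → Set) → Fin N → Set
  Next P i = ∃[ j ] toℕ j ≡ suc (toℕ i) × P j

  -- In `m + suc n ≡ N` the number `n` counts the positions after `m`; the hypothesis here provides
  -- at least one.
  successor : ∀ {m n} → m + suc (suc n) ≡ N → ∃[ j ] toℕ {N} j ≡ suc m
  successor {m} {n} e = fromℕ< m<N , toℕ-fromℕ< m<N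
    where
    m<N : suc m < N
    m<N = ≤-trans (s≤s (s≤s (m≤m+n m n)))
            (≤-reflexive (trans (sym (trans (+-suc m (suc n)) (cong suc (+-suc m n)))) e))

  shift : ∀ {m n} → m + suc (suc n) ≡ N → suc m + suc n ≡ N
  shift {m} {n} e = trans (sym (+-suc m (suc n))) e

  no-successor : ∀ {m} → m + 1 ≡ N → (j : Fin N) → ¬ suc m ≤ toℕ j
  no-successor {m} e j m<j =
    <-irrefl refl (<-≤-trans (toℕ<n j) (≤-trans (≤-reflexive (trans (sym e) (+-comm m 1))) m<j))

  split≤ : ∀ {i j : Fin N} → i Fin.≤ j → i Fin.< j ⊎ i ≡ j
  split≤ i≤j = Sum.map₂ toℕ-injective (m≤n⇒m<n∨m≡n i≤j)

  until-here : ∀ {P Q i} → Q i → Until P Q i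
  until-here {i = i} q = i , ≤-refl , q ,
    λ l i≤l l<i → contradiction (≤-<-trans i≤l l<i) (<-irrefl refl)

  until-later : ∀ {P Q i i′} → toℕ i′ ≡ suc (toℕ i) → P i → Until P Q i′ → Until P Q i
  until-later {P} {i = i} {i′} e p (j , i′≤j , q , ps) =
    j , ≤-trans (n≤1+n _) (subst (_≤ toℕ j) e i′≤j) , q , before
    where
    before : ∀ l → i Fin.≤ l → l Fin.< j → P l
    before l i≤l l<j with split≤ {i} {l} i≤l
    ... | inj₁ i<l  = ps l (subst (_≤ toℕ l) (sym e) i<l) l<j
    ... | inj₂ refl = p

  release⇒¬until : ∀ {P Q i} → Release P Q i → ¬ Until (¬_ ∘ P) (¬_ ∘ Q) i
  release⇒¬until (inj₁ qs) (j , i≤j , ¬q , _) = ¬q (qs j i≤j)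
  release⇒¬until (inj₂ (j′ , i≤j′ , (p , q) , qs)) (j , i≤j , ¬q , ¬ps) with <-cmp (toℕ j) (toℕ j′)
  ... | tri< j<j′ _ _ = ¬q (qs j i≤j j<j′)
  ... | tri≈ _ j≡j′ _ with refl ← toℕ-injective j≡j′ = ¬q q
  ... | tri> _ _ j′<j = ¬ps j′ i≤j′ j′<j p

  -- Release is the dual of until, also at the end of a finite path. Induction on the number `n` of
  -- positions after `i`: where `Q` holds and `P` fails, the absence of an until passes to the
  -- successor, if there is one.
  ¬until⇒release : ∀ {P Q} → (∀ i → Dec (P i)) → (∀ i → Dec (Q i)) → ∀ i n → toℕ i + suc n ≡ N →
                  ¬ Until (¬_ ∘ P) (¬_ ∘ Q) i → Release P Q i
  ¬until⇒release {P} {Q} P? Q? i n e ¬u with Q? i | P? i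
  ... | no ¬q | _     = contradiction (until-here ¬q) ¬u
  ... | yes q | yes p = inj₂ (i , ≤-refl , (p , q) ,
    λ l i≤l l<i → contradiction (≤-<-trans i≤l l<i) (<-irrefl refl))
  ... | yes q | no ¬p = later n e
    where
    later : ∀ n → toℕ i + suc n ≡ N → Release P Q i
    later zero e = inj₁ λ j i≤j → case j (split≤ {i} {j} i≤j)
      where
      case : ∀ j → i Fin.< j ⊎ i ≡ j → Q j
      case j (inj₁ i<j)  = contradiction i<j (no-successor e j)
      case j (inj₂ refl) = q
    later (suc n) e with i′ , e′ ← successor e
      with ¬until⇒release P? Q? i′ n (trans (cong (_+ suc n) e′) (shift e)) (¬u ∘ until-later e′ ¬p)
    ... | inj₁ qs = inj₁ λ j i≤j → case j (split≤ {i} {j} i≤j)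
      where
      case : ∀ j → i Fin.< j ⊎ i ≡ j → Q j
      case j (inj₁ i<j)  = qs j (subst (_≤ toℕ j) (sym e′) i<j)
      case j (inj₂ refl) = q
    ... | inj₂ (j , i′≤j , pq , qs) =
      inj₂ (j , ≤-trans (n≤1+n _) (subst (_≤ toℕ j) e′ i′≤j) , pq , before)
      where
      before : ∀ l → i Fin.≤ l → l Fin.< j → Q l
      before l i≤l l<j with split≤ {i} {l} i≤l
      ... | inj₁ i<l  = qs l (subst (_≤ toℕ l) (sym e′) i<l) l<j
      ... | inj₂ refl = q

  module Words {A : Set} (x : ℕ → A → Bool) where

    -- The second equation makes the segment end at the last position. `m` is kept apart from
    -- `toℕ i` so that a successor can be supplied through its equation.
    Expresses : LTL A κ → (Fin N → Set) → Set
    Expresses Φ P = ∀ i {m} n → toℕ i ≡ m → m + suc n ≡ N → P i ⇔ sat Φ (segment x m (suc n)) ≡ true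

    expresses-neg : ∀ Φ {P} → Expresses Φ P → Expresses (neg Φ) (¬_ ∘ P)
    expresses-neg Φ p i n e e′ = mk⇔
      (λ ¬p → not-true⁺ _ (¬p ∘ Equivalence.from (p i n e e′)))
      (λ q → not-true⁻ _ q ∘ Equivalence.to (p i n e e′))

    expresses-or : ∀ (Φ Ψ : LTL A κ) {P Q} → Expresses Φ P → Expresses Ψ Q →
                   Expresses (Φ or Ψ) (λ i → P i ⊎ Q i)
    expresses-or Φ Ψ p q i n e e′ = mk⇔
      (∨-true⁺ _ ∘ Sum.map (Equivalence.to (p i n e e′)) (Equivalence.to (q i n e e′)))
      (Sum.map (Equivalence.from (p i n e e′)) (Equivalence.from (q i n e e′)) ∘ ∨-true⁻ _)

    expresses-next : ∀ (Φ : LTL A κ) {P} → Expresses Φ P → Expresses (next Φ) (Next P)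
    expresses-next Φ p i zero    refl e′ = mk⇔
      (λ (j , j≡ , _) → contradiction (≤-reflexive (sym j≡)) (no-successor e′ j)) λ ()
    expresses-next Φ p i (suc n) refl e′ = mk⇔
      (λ (j , j≡ , r) → Equivalence.to (p j n j≡ (shift e′)) r)
      (λ r → let j , j≡ = successor e′ in j , j≡ , Equivalence.from (p j n j≡ (shift e′)) r)

    expresses-until : ∀ (Φ Ψ : LTL A κ) {P Q} → Expresses Φ P → Expresses Ψ Q →
                      Expresses (Φ until Ψ) (Until P Q)
    expresses-until Φ Ψ {P} {Q} p q i n refl e′ = mk⇔ (to i n e′) (from i n e′)
      where
      to : ∀ i n → toℕ i + suc n ≡ N → Until P Q i → sat (Φ until Ψ) (segment x (toℕ i) (suc n)) ≡ true
      to i n e (j , i≤j , r , ps) with split≤ {i} {j} i≤j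
      ... | inj₂ refl = ∨-true⁺ _ (inj₁ (Equivalence.to (q i n refl e) r))
      to i zero    e (j , i≤j , r , ps) | inj₁ i<j = contradiction i<j (no-successor e j)
      to i (suc n) e (j , i≤j , r , ps) | inj₁ i<j =
        ∨-true⁺ _ (inj₂ (∧-true⁺ _ (Equivalence.to (p i (suc n) refl e) (ps i ≤-refl i<j) , rest)))
        where
        i′ = proj₁ (successor e)
        i′≡ = proj₂ (successor e)
        rest : sat (Φ until Ψ) (segment x (suc (toℕ i)) (suc n)) ≡ true
        rest = subst (λ m → sat (Φ until Ψ) (segment x m (suc n)) ≡ true) i′≡
          (to i′ n (trans (cong (_+ suc n) i′≡) (shift e))
            (j , subst (_≤ toℕ j) (sym i′≡) i<j , r ,
             λ l i′≤l → ps l (≤-trans (n≤1+n _) (subst (_≤ toℕ l) i′≡ i′≤l))))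

      from : ∀ i n → toℕ i + suc n ≡ N → sat (Φ until Ψ) (segment x (toℕ i) (suc n)) ≡ true → Until P Q i
      from i n e r with ∨-true⁻ _ r
      ... | inj₁ r′ = until-here (Equivalence.from (q i n refl e) r′)
      from i zero    e r | inj₂ r′ =
        contradiction (proj₂ (∧-true⁻ (sat Φ (segment x (toℕ i) 1)) r′)) λ ()
      from i (suc n) e r | inj₂ r′ with a , b ← ∧-true⁻ _ r′ | i′ , i′≡ ← successor e =
        until-later i′≡ (Equivalence.from (p i (suc n) refl e) a)
          (from i′ n (trans (cong (_+ suc n) i′≡) (shift e))
            (subst (λ m → sat (Φ until Ψ) (segment x m (suc n)) ≡ true) (sym i′≡) b))

-- Paths

module F = CTL*f
module P = CTL*±

module Paths {k : ℕ} (t : Tree k) where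
  open Tree t
  open FinitePath
  open InfinitePath

  extend : ∀ n → (Fin (suc n) → Node) → ℕ → Node
  extend n       a zero    = a Fin.zero
  extend zero    a (suc m) = proj₁ (leafless (extend zero a m))
  extend (suc n) a (suc m) = extend n (a ∘ Fin.suc) m

  extend-toℕ : ∀ n a i → extend n a (toℕ i) ≡ a i
  extend-toℕ n       a Fin.zero    = refl
  extend-toℕ (suc n) a (Fin.suc i) = extend-toℕ n (a ∘ Fin.suc) i

  extend-step : ∀ n (a : Fin (suc n) → Node) → (∀ i → Child (a (Fin.inject₁ i)) (a (Fin.suc i))) →
                ∀ m → Child (extend n a m) (extend n a (suc m))
  extend-step zero    a st m       = proj₂ (leafless (extend zero a m))
  extend-step (suc n) a st zero    = st Fin.zero
  extend-step (suc n) a st (suc m) = extend-step n (a ∘ Fin.suc) (st ∘ Fin.suc) m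

  infinite : FinitePath t → InfinitePath t
  infinite π .at   = extend (last π) (at π)
  infinite π .step = extend-step (last π) (at π) (step π)

  truncate : InfinitePath t → ℕ → FinitePath t
  truncate π n .last   = n
  truncate π n .at     = at π ∘ toℕ
  truncate π n .step i = subst (λ m → Child (at π m) (at π (suc (toℕ i)))) (sym (toℕ-inject₁ i)) (step π (toℕ i))

-- Path formulae as temporal formulae over state formulae

fromPath : ∀ {k} → P.PathFormula k → LTL (P.StateFormula k) positive
fromPath (P.state φ)  = lit (var φ)
fromPath (ψ₁ P.∧ ψ₂) = fromPath ψ₁ and fromPath ψ₂
fromPath (ψ₁ P.∨ ψ₂) = fromPath ψ₁ or fromPath ψ₂
fromPath (P.X ψ)      = next (fromPath ψ)
fromPath (ψ₁ P.U ψ₂) = fromPath ψ₁ until fromPath ψ₂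

module _ {k : ℕ} (d : P.StateFormula k) where

  -- There is no formula at all when k = 0, so the constants are built from a
  -- given formula d.
  collapse : BoolExpr (P.StateFormula k) → P.StateFormula k
  collapse (const true)  = d P.∨ P.neg d
  collapse (const false) = P.neg (d P.∨ P.neg d)
  collapse (var φ)       = φ
  collapse (neg α)       = P.neg (collapse α)
  collapse (α or β)      = collapse α P.∨ collapse β
  collapse (α and β)     = P.neg (P.neg (collapse α) P.∨ P.neg (collapse β))

  toPath : LTL (P.StateFormula k) positive → P.PathFormula k
  toPath (lit α)     = P.state (collapse α)
  toPath (Φ or Ψ)    = toPath Φ P.∨ toPath Ψ
  toPath (Φ and Ψ)   = toPath Φ P.∧ toPath Ψ
  toPath (next Φ)    = P.X (toPath Φ)
  toPath (Φ until Ψ) = toPath Φ P.U toPath Ψ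

-- Truth along paths as satisfaction in finite words

module Semantics (em : ExcludedMiddle 0ℓ) {k : ℕ} (t : Tree k) where
  open Tree t
  open Paths t
  open FinitePath
  open InfinitePath

  -- Excluded middle turns truth at a node into a bit. It serves the correctness proofs only; the
  -- translations are defined without it.
  letter : Node → P.StateFormula k → Bool
  letter u φ = does (em {P._⊨_ t u φ})

  letter⁺ : ∀ u φ → P._⊨_ t u φ → letter u φ ≡ true
  letter⁺ u φ = dec-true em

  letter⁻ : ∀ u φ → letter u φ ≡ true → P._⊨_ t u φ
  letter⁻ u φ p with yes q ← em {P._⊨_ t u φ} = q

  letter-neg : ∀ u φ → letter u (P.neg φ) ≡ not (letter u φ)
  letter-neg u φ with em {P._⊨_ t u φ}
  ... | yes p = dec-false em (λ ¬p → ¬p p)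
  ... | no ¬p = dec-true em ¬p

  letter-or : ∀ u φ₁ φ₂ → letter u (φ₁ P.∨ φ₂) ≡ letter u φ₁ ∨ letter u φ₂
  letter-or u φ₁ φ₂ with em {P._⊨_ t u φ₁} | em {P._⊨_ t u φ₂}
  ... | yes p | _     = dec-true em (inj₁ p)
  ... | no ¬p | yes q = dec-true em (inj₂ q)
  ... | no ¬p | no ¬q = dec-false em Sum.[ ¬p , ¬q ]

  word : InfinitePath t → ℕ → ℕ → Word (P.StateFormula k)
  word π = segment (letter ∘ at π)

  -- Only finitely many positions are consulted; `sat-mono` brings the segments needed by the
  -- subformulae to a common length.
  fromPath⁺ : ∀ π ψ i → P._,_⊨ᵖ_ t π i ψ → ∃[ n ] sat (fromPath ψ) (word π i n) ≡ true
  fromPath⁺ π (P.state φ)  i p = 1 , letter⁺ (at π i) φ p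
  fromPath⁺ π (ψ₁ P.∧ ψ₂) i (p , q)
    with m , p′ ← fromPath⁺ π ψ₁ i p | n , q′ ← fromPath⁺ π ψ₂ i q =
    m ⊔ n , trans (sat-and (fromPath ψ₁) (fromPath ψ₂) (word π i (m ⊔ n)))
      (∧-true⁺ _ (sat-mono (fromPath ψ₁) _ i (m≤m⊔n m n) p′ , sat-mono (fromPath ψ₂) _ i (m≤n⊔m m n) q′))
  fromPath⁺ π (ψ₁ P.∨ ψ₂) i (inj₁ p) with n , p′ ← fromPath⁺ π ψ₁ i p =
    n , trans (sat-or (fromPath ψ₁) (fromPath ψ₂) (word π i n)) (∨-true⁺ _ (inj₁ p′))
  fromPath⁺ π (ψ₁ P.∨ ψ₂) i (inj₂ p) with n , p′ ← fromPath⁺ π ψ₂ i p =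
    n , trans (sat-or (fromPath ψ₁) (fromPath ψ₂) (word π i n)) (∨-true⁺ _ (inj₂ p′))
  fromPath⁺ π (P.X ψ)      i p with n , p′ ← fromPath⁺ π ψ (suc i) p = suc n , p′
  fromPath⁺ π (ψ₁ P.U ψ₂) i (j , i≤j , q , ps) =
    go (j ∸ i) i (m+[n∸m]≡n i≤j) (λ l i≤l l<j → fromPath⁺ π ψ₁ l (ps l i≤l l<j))
    where
    Ψ = fromPath ψ₁ until fromPath ψ₂
    go : ∀ d i → i + d ≡ j →
         (∀ l → i ≤ l → l < j → ∃[ n ] sat (fromPath ψ₁) (word π l n) ≡ true) →
         ∃[ n ] sat Ψ (word π i n) ≡ true
    go zero    i e ps rewrite trans (sym (+-identityʳ i)) e with fromPath⁺ π ψ₂ j q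
    ... | suc n , q′ = suc n , ∨-true⁺ _ (inj₁ q′)
    go (suc d) i e ps
      with m , p ← ps i ≤-refl (≤-trans (s≤s (m≤m+n i d)) (≤-reflexive (trans (sym (+-suc i d)) e)))
         | n , r ← go d (suc i) (trans (sym (+-suc i d)) e) (λ l i<l → ps l (<⇒≤ i<l)) =
      -- `m` letters from `i` serve `ψ₁` and `n` letters from `suc i` serve the rest; this many
      -- letters from `i` cover both.
      suc (m ⊔ n) , ∨-true⁺ _ (inj₂ (∧-true⁺ _
        ( sat-mono (fromPath ψ₁) _ i (≤-trans (m≤m⊔n m n) (n≤1+n _)) p
        , sat-mono Ψ _ (suc i) (m≤n⊔m m n) r)))

  fromPath⁻ : ∀ π ψ i n → sat (fromPath ψ) (word π i n) ≡ true → P._,_⊨ᵖ_ t π i ψ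
  fromPath⁻ π (P.state φ)  i (suc n) p = letter⁻ (at π i) φ p
  fromPath⁻ π (ψ₁ P.∧ ψ₂) i (suc n) p =
    Product.map (fromPath⁻ π ψ₁ i (suc n)) (fromPath⁻ π ψ₂ i (suc n)) (∧-true⁻ _ p)
  fromPath⁻ π (ψ₁ P.∨ ψ₂) i (suc n) p =
    Sum.map (fromPath⁻ π ψ₁ i (suc n)) (fromPath⁻ π ψ₂ i (suc n)) (∨-true⁻ _ p)
  fromPath⁻ π (P.X ψ)      i (suc n) p = fromPath⁻ π ψ (suc i) n p
  fromPath⁻ π (ψ₁ P.U ψ₂) i n       p = go i n p
    where
    go : ∀ i n → sat (fromPath ψ₁ until fromPath ψ₂) (word π i n) ≡ true →
         ∃[ j ] i ≤ j × P._,_⊨ᵖ_ t π j ψ₂ × (∀ m → i ≤ m → m < j → P._,_⊨ᵖ_ t π m ψ₁)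
    go i (suc n) p with ∨-true⁻ _ p
    ... | inj₁ q = i , ≤-refl , fromPath⁻ π ψ₂ i (suc n) q ,
      λ m i≤m m<i → contradiction (≤-<-trans i≤m m<i) (<-irrefl refl)
    ... | inj₂ q with r , r′ ← ∧-true⁻ _ q with j , i<j , s , ps ← go (suc i) n r′ =
      j , <⇒≤ i<j , s , before
      where
      before : ∀ m → i ≤ m → m < j → P._,_⊨ᵖ_ t π m ψ₁
      before m i≤m m<j with m≤n⇒m<n∨m≡n i≤m
      ... | inj₁ i<m  = ps m i<m m<j
      ... | inj₂ refl = fromPath⁻ π ψ₁ i (suc n) r

  letter-collapse : ∀ u d α → letter u (collapse d α) ≡ eval α (letter u)
  letter-collapse u d (const true)  =
    trans (letter-or u d (P.neg d)) (trans (cong (letter u d ∨_) (letter-neg u d)) (∨-inverseʳ (letter u d)))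
  letter-collapse u d (const false) =
    trans (letter-neg u _) (cong not (letter-collapse u d (const true)))
  letter-collapse u d (var φ)       = refl
  letter-collapse u d (neg α)       = trans (letter-neg u _) (cong not (letter-collapse u d α))
  letter-collapse u d (α or β)      =
    trans (letter-or u _ _) (cong₂ _∨_ (letter-collapse u d α) (letter-collapse u d β))
  letter-collapse u d (α and β)     = begin
    letter u (P.neg (P.neg (collapse d α) P.∨ P.neg (collapse d β)))
      ≡⟨ trans (letter-neg u _) (cong not (letter-or u _ _)) ⟩
    not (letter u (P.neg (collapse d α)) ∨ letter u (P.neg (collapse d β)))
      ≡⟨ cong₂ (λ a b → not (a ∨ b)) (trans (letter-neg u _) (cong not (letter-collapse u d α)))
                                   (trans (letter-neg u _) (cong not (letter-collapse u d β))) ⟩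
    not (not (eval α (letter u)) ∨ not (eval β (letter u)))
      ≡⟨ de-morgan (eval α (letter u)) _ ⟩
    eval α (letter u) ∧ eval β (letter u) ∎
    where open ≡-Reasoning

  sat-toPath : ∀ d Φ π i n → sat (fromPath (toPath d Φ)) (word π i n) ≡ sat Φ (word π i n)
  sat-toPath d Φ           π i zero    = refl
  sat-toPath d (lit α)     π i (suc n) = letter-collapse (at π i) d α
  sat-toPath d (Φ or Ψ)    π i (suc n) = cong₂ _∨_ (sat-toPath d Φ π i (suc n)) (sat-toPath d Ψ π i (suc n))
  sat-toPath d (Φ and Ψ)   π i (suc n) = cong₂ _∧_ (sat-toPath d Φ π i (suc n)) (sat-toPath d Ψ π i (suc n))
  sat-toPath d (next Φ)    π i (suc n) = sat-toPath d Φ π (suc i) n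
  sat-toPath d (Φ until Ψ) π i (suc n) =
    cong₂ _∨_ (sat-toPath d Ψ π i (suc n))
      (cong₂ _∧_ (sat-toPath d Φ π i (suc n)) (sat-toPath d (Φ until Ψ) π (suc i) n))

  -- The meeting point of the two logics: `E` and `Ef` each amount to a run of a suitable formula.
  Run : LTL (P.StateFormula k) κ → Node → Set
  Run Φ u = Σ[ π ∈ InfinitePath t ] at π 0 ≡ root ×
              (∃[ i ] at π i ≡ u × (∃[ n ] sat Φ (word π i n) ≡ true))

  E⇔Run : ∀ ψ u → P._⊨_ t u (P.E ψ) ⇔ Run (fromPath ψ) u
  E⇔Run ψ u = mk⇔
    (λ (π , r , i , e , p) → π , r , i , e , fromPath⁺ π ψ i p)
    (λ (π , r , i , e , n , p) → π , r , i , e , fromPath⁻ π ψ i n p)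

  -- Words are read off an infinite path continuing `π`, so that finite and infinite paths share
  -- them.
  Expressesᶠ : LTL (P.StateFormula k) κ → F.PathFormula k → Set
  Expressesᶠ Φ ψ = ∀ (π : FinitePath t) (π∞ : InfinitePath t) → (∀ i → at π∞ (toℕ i) ≡ at π i) →
    Positions.Words.Expresses (suc (last π)) (letter ∘ at π∞) Φ (λ i → F._,_⊨ᵖ_ t π i ψ)

  -- A finite path extends because the tree is leafless; conversely, the infinite path is cut at the
  -- end of the segment.
  Ef⇔Run : (Φ : LTL (P.StateFormula k) κ) → ∀ ψ → Expressesᶠ Φ ψ → ∀ u → F._⊨_ t u (F.Ef ψ) ⇔ Run Φ u
  Ef⇔Run Φ ψ ex u = mk⇔ to from
    where
    to : F._⊨_ t u (F.Ef ψ) → Run Φ u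
    to (π , r , i , e , p) =
      infinite π , r , toℕ i , trans (agree i) e , suc (last π ∸ toℕ i) ,
      Equivalence.to (ex π (infinite π) agree i (last π ∸ toℕ i) refl
        (trans (+-suc (toℕ i) _) (cong suc (m+[n∸m]≡n (toℕ≤pred[n] i))))) p
      where
      agree = extend-toℕ (last π) (at π)

    from : Run Φ u → F._⊨_ t u (F.Ef ψ)
    from (π , r , i , e , suc n , p) =
      -- The `suc n` letters from `i` end at position `i + n`, which becomes the last one; an empty
      -- segment satisfies nothing.
      truncate π (i + n) , r , i′ , trans (cong (at π) i′≡) e ,
      Equivalence.from (ex (truncate π (i + n)) π (λ _ → refl) i′ n i′≡ (+-suc i n)) p
      where
      i′ = fromℕ< (s≤s (m≤m+n i n))
      i′≡ = toℕ-fromℕ< (s≤s (m≤m+n i n))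

  -- A run may choose the length of its segment, so a prefix of the segment serves as well;
  -- conversely, the segment is a prefix of itself.
  Run-somePrefix : ∀ Φ u → Run Φ u ⇔ Run (somePrefix Φ) u
  Run-somePrefix Φ u = mk⇔
    (λ (π , r , i , e , n , p) → π , r , i , e , n , sat-somePrefix⁺ Φ (word π i n) p)
    from
    where
    from : Run (somePrefix Φ) u → Run Φ u
    from (π , r , i , e , n , p) with m , m≤ , q ← sat-somePrefix⁻ Φ (word π i n) p =
      π , r , i , e , m ,
      subst (λ xs → sat Φ xs ≡ true) (take-segment _ i (subst (m ≤_) (length-segment _ i n) m≤)) q

  Run-toPath : ∀ d Φ u → Run Φ u ⇔ Run (fromPath (toPath d Φ)) u
  Run-toPath d Φ u = mk⇔
    (λ (π , r , i , e , n , p) → π , r , i , e , n , trans (sat-toPath d Φ π i n) p)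
    (λ (π , r , i , e , n , p) → π , r , i , e , n , trans (sym (sat-toPath d Φ π i n)) p)

AtLeastChildren-⇔ : ∀ {k} (t : Tree k) n u {P Q} → (∀ v → P v ⇔ Q v) →
                    AtLeastChildren t n u P ⇔ AtLeastChildren t n u Q
AtLeastChildren-⇔ t n u p = mk⇔
  (λ (c , inj , h) → c , inj , λ i → Product.map₂ (Equivalence.to (p (c i))) (h i))
  (λ (c , inj , h) → c , inj , λ i → Product.map₂ (Equivalence.from (p (c i))) (h i))

-- The translations

f→± : ∀ {k} → F.StateFormula k → P.StateFormula k
f→LTL : ∀ {k} → F.PathFormula k → LTL (P.StateFormula k) full
-- Every path formula contains a state formula; the translation of one serves as the `d` of
-- `collapse`.
someState : ∀ {k} → F.PathFormula k → P.StateFormula k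

f→± (F.atom p)   = P.atom p
f→± (F.neg φ)    = P.neg (f→± φ)
f→± (φ₁ F.∨ φ₂) = f→± φ₁ P.∨ f→± φ₂
f→± (F.D n φ)    = P.D n (f→± φ)
f→± (F.Ef ψ)     = P.E (toPath (someState ψ) (somePrefix (f→LTL ψ)))

f→LTL (F.state φ)  = lit (var (f→± φ))
f→LTL (F.neg ψ)    = neg (f→LTL ψ)
f→LTL (ψ₁ F.∨ ψ₂) = f→LTL ψ₁ or f→LTL ψ₂
f→LTL (F.X ψ)      = next (f→LTL ψ)
f→LTL (ψ₁ F.U ψ₂) = f→LTL ψ₁ until f→LTL ψ₂
f→LTL (ψ₁ F.R ψ₂) = neg (neg (f→LTL ψ₁) until neg (f→LTL ψ₂))

someState (F.state φ)  = f→± φ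
someState (F.neg ψ)    = someState ψ
someState (ψ₁ F.∨ ψ₂) = someState ψ₁
someState (F.X ψ)      = someState ψ
someState (ψ₁ F.U ψ₂) = someState ψ₁
someState (ψ₁ F.R ψ₂) = someState ψ₁

±→f : ∀ {k} → P.StateFormula k → F.StateFormula k
±→fᵖ : ∀ {k} → P.PathFormula k → F.PathFormula k

±→f (P.atom p)   = F.atom p
±→f (P.neg φ)    = F.neg (±→f φ)
±→f (φ₁ P.∨ φ₂) = ±→f φ₁ F.∨ ±→f φ₂
±→f (P.D n φ)    = F.D n (±→f φ)
±→f (P.E ψ)      = F.Ef (±→fᵖ ψ)

±→fᵖ (P.state φ)  = F.state (±→f φ)
±→fᵖ (ψ₁ P.∧ ψ₂) = F.neg (F.neg (±→fᵖ ψ₁) F.∨ F.neg (±→fᵖ ψ₂))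
±→fᵖ (ψ₁ P.∨ ψ₂) = ±→fᵖ ψ₁ F.∨ ±→fᵖ ψ₂
±→fᵖ (P.X ψ)      = F.X (±→fᵖ ψ)
±→fᵖ (ψ₁ P.U ψ₂) = ±→fᵖ ψ₁ F.U ±→fᵖ ψ₂

-- Correctness of the translations

module Correctness (em : ExcludedMiddle 0ℓ) {k : ℕ} (t : Tree k) where
  open Tree t
  open Semantics em t
  open FinitePath
  open InfinitePath

  expresses-state : ∀ φ φ′ → (∀ u → F._⊨_ t u φ ⇔ P._⊨_ t u φ′) →
                    Expressesᶠ {κ} (lit (var φ′)) (F.state φ)
  expresses-state φ φ′ p π π∞ agree i n refl _ = mk⇔
    (λ q → letter⁺ _ φ′ (subst (λ u → P._⊨_ t u φ′) (sym (agree i)) (Equivalence.to (p (at π i)) q)))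
    (λ q → Equivalence.from (p (at π i)) (subst (λ u → P._⊨_ t u φ′) (agree i) (letter⁻ _ φ′ q)))

  f→±-correct : ∀ φ u → F._⊨_ t u φ ⇔ P._⊨_ t u (f→± φ)
  f→LTL-correct : ∀ ψ → Expressesᶠ (f→LTL ψ) ψ

  f→±-correct (F.atom p)   u = mk⇔ id id
  f→±-correct (F.neg φ)    u =
    mk⇔ (_∘ Equivalence.from (f→±-correct φ u)) (_∘ Equivalence.to (f→±-correct φ u))
  f→±-correct (φ₁ F.∨ φ₂) u = f→±-correct φ₁ u ⊎-⇔ f→±-correct φ₂ u
  f→±-correct (F.D n φ)    u = AtLeastChildren-⇔ t n u (f→±-correct φ)
  f→±-correct (F.Ef ψ)     u =
    -- Read from right to left: from `Ef` to runs of the full formula, to runs of its positive form,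
    -- to runs of the resulting path formula, to `E`.
    (⇔-sym (E⇔Run _ u) ⇔-∘ Run-toPath (someState ψ) (somePrefix (f→LTL ψ)) u)
    ⇔-∘ (Run-somePrefix (f→LTL ψ) u ⇔-∘ Ef⇔Run (f→LTL ψ) ψ (f→LTL-correct ψ) u)

  f→LTL-correct (F.state φ)  = expresses-state {κ = full} φ (f→± φ) (f→±-correct φ)
  f→LTL-correct (F.neg ψ)    π π∞ agree = expresses-neg (f→LTL ψ) (f→LTL-correct ψ π π∞ agree)
    where open Positions.Words (suc (last π)) (letter ∘ at π∞)
  f→LTL-correct (ψ₁ F.∨ ψ₂) π π∞ agree =
    expresses-or (f→LTL ψ₁) (f→LTL ψ₂) (f→LTL-correct ψ₁ π π∞ agree) (f→LTL-correct ψ₂ π π∞ agree)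
    where open Positions.Words (suc (last π)) (letter ∘ at π∞)
  f→LTL-correct (F.X ψ)      π π∞ agree = expresses-next (f→LTL ψ) (f→LTL-correct ψ π π∞ agree)
    where open Positions.Words (suc (last π)) (letter ∘ at π∞)
  f→LTL-correct (ψ₁ F.U ψ₂) π π∞ agree =
    expresses-until (f→LTL ψ₁) (f→LTL ψ₂) (f→LTL-correct ψ₁ π π∞ agree) (f→LTL-correct ψ₂ π π∞ agree)
    where open Positions.Words (suc (last π)) (letter ∘ at π∞)
  f→LTL-correct (ψ₁ F.R ψ₂) π π∞ agree i n refl e =
    expresses-neg (neg Φ until neg Ψ)
      (expresses-until (neg Φ) (neg Ψ)
        (expresses-neg Φ (f→LTL-correct ψ₁ π π∞ agree))
        (expresses-neg Ψ (f→LTL-correct ψ₂ π π∞ agree)))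
      i n refl e
    ⇔-∘ mk⇔ release⇒¬until (¬until⇒release (λ _ → em) (λ _ → em) i n e)
    where
    open Positions (suc (last π))
    open Words (letter ∘ at π∞)
    Φ = f→LTL ψ₁
    Ψ = f→LTL ψ₂

  ±→f-correct : ∀ φ u → F._⊨_ t u (±→f φ) ⇔ P._⊨_ t u φ
  ±→fᵖ-correct : ∀ ψ → Expressesᶠ (fromPath ψ) (±→fᵖ ψ)

  ±→f-correct (P.atom p)   u = mk⇔ id id
  ±→f-correct (P.neg φ)    u =
    mk⇔ (_∘ Equivalence.from (±→f-correct φ u)) (_∘ Equivalence.to (±→f-correct φ u))
  ±→f-correct (φ₁ P.∨ φ₂) u = ±→f-correct φ₁ u ⊎-⇔ ±→f-correct φ₂ u
  ±→f-correct (P.D n φ)    u = AtLeastChildren-⇔ t n u (±→f-correct φ)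
  ±→f-correct (P.E ψ)      u =
    ⇔-sym (E⇔Run ψ u) ⇔-∘ Ef⇔Run (fromPath ψ) (±→fᵖ ψ) (±→fᵖ-correct ψ) u

  ±→fᵖ-correct (P.state φ)  = expresses-state {κ = positive} (±→f φ) φ (±→f-correct φ)
  ±→fᵖ-correct (ψ₁ P.∧ ψ₂) π π∞ agree i n e e′ = mk⇔
    (λ p → ∧-true⁺ _
      ( Equivalence.to c₁ (decidable-stable em (p ∘ inj₁))
      , Equivalence.to c₂ (decidable-stable em (p ∘ inj₂))))
    (λ p → let p₁ , p₂ = ∧-true⁻ _ p in
      Sum.[ (λ ¬q → ¬q (Equivalence.from c₁ p₁)) , (λ ¬q → ¬q (Equivalence.from c₂ p₂)) ])
    where
    c₁ = ±→fᵖ-correct ψ₁ π π∞ agree i n e e′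
    c₂ = ±→fᵖ-correct ψ₂ π π∞ agree i n e e′
  ±→fᵖ-correct (ψ₁ P.∨ ψ₂) π π∞ agree =
    expresses-or (fromPath ψ₁) (fromPath ψ₂) (±→fᵖ-correct ψ₁ π π∞ agree) (±→fᵖ-correct ψ₂ π π∞ agree)
    where open Positions.Words (suc (last π)) (letter ∘ at π∞)
  ±→fᵖ-correct (P.X ψ)      π π∞ agree = expresses-next (fromPath ψ) (±→fᵖ-correct ψ π π∞ agree)
    where open Positions.Words (suc (last π)) (letter ∘ at π∞)
  ±→fᵖ-correct (ψ₁ P.U ψ₂) π π∞ agree =
    expresses-until (fromPath ψ₁) (fromPath ψ₂) (±→fᵖ-correct ψ₁ π π∞ agree) (±→fᵖ-correct ψ₂ π π∞ agree)
    where open Positions.Words (suc (last π)) (letter ∘ at π∞)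

theorem3p7 : (k : ℕ) →
    (Σ[ f ∈ (CTL*f.StateFormula k → CTL*±.StateFormula k) ]
    (ExcludedMiddle 0ℓ → ∀ φ → InitiallyEquivalent (CTL*f.Models φ) (CTL*±.Models (f φ))))
    ×
    (Σ[ g ∈ (CTL*±.StateFormula k → CTL*f.StateFormula k) ]
    (ExcludedMiddle 0ℓ → ∀ φ → InitiallyEquivalent (CTL*±.Models φ) (CTL*f.Models (g φ))))
theorem3p7 k =
  (f→± , λ em φ t → Correctness.f→±-correct em t φ (Tree.root t)) ,
  (±→f , λ em φ t → ⇔-sym (Correctness.±→f-correct em t φ (Tree.root t)))
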